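{- Let a natural deduction theory with classifier $p:\mathbb P\to\mathbf{ctx}$ be given, with entailment classifier $e:\mathbb E\to\mathbf{ctx}$. The relation captured by $e$ is transitive in the sense that the rule $$\frac{x;\psi\vdash\phi\qquad x;\phi\vdash\chi}{x;\psi\vdash\chi}\ (T)$$ is in the theory. That is, there is a functor $t:\mathbb E d.c\mathbb E\to\mathbb E$ belonging to the rules $\mathscr R$ of the theory that sends a pair $(\psi\to\phi,\ \phi\to\chi)$ of composable vertical arrows over $x$ to the vertical arrow $\psi\to\chi$ over $x$.
   Context: Judgemental theory: a category $\mathbf{ctx}$ with terminal object, a set $\mathscr R$ of functors ("rules"), of which those with codomain $\mathbf{ctx}$ are the "judgements" $\mathscr J$, and a set $\mathscr P$ of natural transformations ("policies") filling triangles of rules, such that: $\mathscr R,\mathscr P$ are closed under composition and under finite limits (pullbacks, equalizers, finite powers $\mathcal X^n$ and arrow categories $\mathcal X^{\mathsf 2}$ with $\mathrm{dom},\mathrm{cod}$ and the tautological transformation $\mathrm{dom}\Rightarrow\mathrm{cod}$; projections and functors induced by cones of rules are again in $\mathscr R$), $\mathscr P$ is closed under whiskering with rules, and the theory is closed under $\sharp$-liftings: given rules $\lambda:\mathcal F\to\mathcal G$, $r:\mathcal F\to\mathcal X$, $r':\mathcal G\to\mathcal X$, a policy $\lambda^\sharp:r'\lambda\Rightarrow r$ and a rule $h:\mathcal H\to\mathcal X$ which is a fibration, the functor $\mathcal F\times_{\mathcal X}\mathcal H\to\mathcal G\times_{\mathcal X}\mathcal H$, $(F,H)\mapsto(\lambda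 F,H[\lambda^\sharp_F])$ is in $\mathscr R$, and the natural transformation with components the cartesian lifts $H[\lambda^\sharp_F]\to H$ is in $\mathscr P$ (and dually for opfibrations). Natural deduction theory (NDT): the judgemental theory generated by one classifier $p:\mathbb P\to\mathbf{ctx}$, where $\mathbf{ctx}$ is the category of finite sets and $p$ is a faithful fibration with fibered finite products $\wedge$, fibered implication and fibered initial objects (these operators being counted among the rules). It is required to be substitutional: judgement classifiers are fibrations, rules preserve cartesian maps, policies have cartesian components. Entailment classifier: let $I:\mathbf{ctx}\to\mathbf{ctx}^{\mathsf 2}$, $x\mapsto\mathrm{id}_x$; $\mathbb E$ is the pullback of $p^{\mathsf 2}:\mathbb P^{\mathsf 2}\to\mathbf{ctx}^{\mathsf 2}$ along $I$, i.e. the category of $p$-vertical arrows, with projection $e:\mathbb E\to\mathbf{ctx}$. Write $d,c:\mathbb E\to\mathbb P$ for domain and codomain. The judgement $x;\psi\vdash\phi$ means that there is an object $\psi\to\phi$ of $\mathbb E$ over $x$. $\mathbb E d.c\mathbb E$ is the pullback of $c:\mathbb E\to\mathbb P$ along $d:\mathbb E\to\mathbb P$, i.e. the category of composable pairs of vertical arrows. -}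

module Defs where

open import Axiom.UniquenessOfIdentityProofs.WithK using (uip)
open import Data.Fin.Base using (Fin; zero; suc)
open import Data.Nat.Base using (ℕ; zero; suc)
open import Data.Product using (Σ; _×_; _,_; proj₁; proj₂; ∃!)
open import Data.Unit.Polymorphic using (⊤; tt)
open import Data.Vec.Base using (Vec; lookup; tabulate)
open import Data.Vec.Properties using (lookup∘tabulate; tabulate-cong; tabulate∘lookup)
open import Function.Base using () renaming (_∘_ to _∘′_)
open import Function.Bundles using (_↔_; Inverse; mk↔ₛ′)
open import Level using (Level) renaming (suc to lsuc)
open import Relation.Binary.PropositionalEquality hiding ([_])

private variable
  ℓ : Level

------------------------------------------------------------------------
-- Categories

-- Objects are compared by _≡_, so that pullbacks of categories are the
-- strict ones.  Since arrow categories have morphisms inside their objects,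
-- morphisms are compared by _≡_ as well.

record Category (ℓ : Level) : Set (lsuc (lsuc ℓ)) where
  infixr 9 _∘_
  field
    Obj       : Set (lsuc ℓ)
    Hom       : Obj → Obj → Set ℓ
    id        : ∀ {A} → Hom A A
    _∘_       : ∀ {A B C} → Hom B C → Hom A B → Hom A C
    identityˡ : ∀ {A B} (f : Hom A B) → id ∘ f ≡ f
    identityʳ : ∀ {A B} (f : Hom A B) → f ∘ id ≡ f
    assoc     : ∀ {A B C D} (h : Hom C D) (g : Hom B C) (f : Hom A B) →
                (h ∘ g) ∘ f ≡ h ∘ (g ∘ f)

open Category public using (Obj)

-- Equality of morphisms whose end points are not known to coincide.  It
-- contains the equality of the end points.

module _ {C : Category ℓ} where
  open Category C

  infix 4 _≋_
  data _≋_ {A B : Obj C} (f : Hom A B) : {A′ B′ : Obj C} → Hom A′ B′ → Set ℓ where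
    refl : f ≋ f

  ≋-reflexive : ∀ {A B} {f g : Hom A B} → f ≡ g → f ≋ g
  ≋-reflexive refl = refl

  ≋⇒≡ : ∀ {A B} {f g : Hom A B} → f ≋ g → f ≡ g
  ≋⇒≡ refl = refl

  ≋-sym : ∀ {A B A′ B′} {f : Hom A B} {g : Hom A′ B′} → f ≋ g → g ≋ f
  ≋-sym refl = refl

  ≋-trans : ∀ {A B A′ B′ A″ B″} {f : Hom A B} {g : Hom A′ B′} {h : Hom A″ B″} →
            f ≋ g → g ≋ h → f ≋ h
  ≋-trans refl refl = refl

  ≋-dom : ∀ {A B A′ B′} {f : Hom A B} {g : Hom A′ B′} → f ≋ g → A ≡ A′
  ≋-dom refl = refl

  ≋-∘ : ∀ {A B D A′ B′ D′} {g : Hom B D} {f : Hom A B} {g′ : Hom B′ D′} {f′ : Hom A′ B′} →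
        g ≋ g′ → f ≋ f′ → g ∘ f ≋ g′ ∘ f′
  ≋-∘ refl refl = refl

  ≋-id : ∀ {A B : Obj C} → A ≡ B → id {A} ≋ id {B}
  ≋-id refl = refl

  ≋-irrelevant : ∀ {A B A′ B′} {f : Hom A B} {g : Hom A′ B′} (p q : f ≋ g) → p ≡ q
  ≋-irrelevant refl refl = refl

infix 4 _[_≋_]
_[_≋_] : ∀ {ℓ} (C : Category ℓ) → let open Category C in
         ∀ {A B A′ B′} → Hom A B → Hom A′ B′ → Set ℓ
C [ f ≋ g ] = _≋_ {C = C} f g

------------------------------------------------------------------------
-- Functors and natural transformations

record Functor (C D : Category ℓ) : Set (lsuc ℓ) where
  private
    module C = Category C
    module D = Category D
  field
    F₀   : Obj C → Obj D
    F₁   : ∀ {A B} → C.Hom A B → D.Hom (F₀ A) (F₀ B)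
    F-id : ∀ {A} → F₁ (C.id {A}) ≡ D.id
    F-∘  : ∀ {A B E} (g : C.Hom B E) (f : C.Hom A B) →
           F₁ (g C.∘ f) ≡ F₁ g D.∘ F₁ f

open Functor public

idF : {C : Category ℓ} → Functor C C
idF .F₀ A   = A
idF .F₁ f   = f
idF .F-id    = refl
idF .F-∘ _ _ = refl

infixr 9 _∘F_
_∘F_ : {C D E : Category ℓ} → Functor D E → Functor C D → Functor C E
(G ∘F F) .F₀ A   = F₀ G (F₀ F A)
(G ∘F F) .F₁ f   = F₁ G (F₁ F f)
(G ∘F F) .F-id    = trans (cong (F₁ G) (F-id F)) (F-id G)
(G ∘F F) .F-∘ g f = trans (cong (F₁ G) (F-∘ F g f)) (F-∘ G (F₁ F g) (F₁ F f))

-- Strict equality of functors; equality on objects is implied.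

infix 4 _≐_
_≐_ : {C D : Category ℓ} → Functor C D → Functor C D → Set (lsuc ℓ)
_≐_ {C = C} {D} F G = ∀ {A B} (f : Hom A B) → D [ F₁ F f ≋ F₁ G f ]
  where open Category C

≐-obj : {C D : Category ℓ} {F G : Functor C D} → F ≐ G → ∀ A → F₀ F A ≡ F₀ G A
≐-obj {C = C} F≐G A = ≋-dom (F≐G (Category.id C {A}))

Faithful : {C D : Category ℓ} → Functor C D → Set (lsuc ℓ)
Faithful {C = C} F = ∀ {A B} {f g : Hom A B} → F₁ F f ≡ F₁ F g → f ≡ g
  where open Category C

record NatTrans {C D : Category ℓ} (F G : Functor C D) : Set (lsuc ℓ) where
  private
    module C = Category C
    module D = Category D
  field
    η       : ∀ A → D.Hom (F₀ F A) (F₀ G A)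
    natural : ∀ {A B} (f : C.Hom A B) → η B D.∘ F₁ F f ≡ F₁ G f D.∘ η A

open NatTrans public

infix 4 _≐ⁿ_
_≐ⁿ_ : {C D : Category ℓ} {F G F′ G′ : Functor C D} →
       NatTrans F G → NatTrans F′ G′ → Set (lsuc ℓ)
_≐ⁿ_ {D = D} α β = ∀ A → D [ η α A ≋ η β A ]

module _ {C D : Category ℓ} where
  private module D = Category D

  idN : {F : Functor C D} → NatTrans F F
  idN .η A             = D.id
  idN {F = F} .natural f = trans (D.identityˡ (F₁ F f)) (sym (D.identityʳ (F₁ F f)))

  infixr 9 _∘N_
  _∘N_ : {F G H : Functor C D} → NatTrans G H → NatTrans F G → NatTrans F H
  (β ∘N α) .η A = η β A D.∘ η α A
  _∘N_ {F} {G} {H} β α .natural {A} {B} f = begin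
    (η β B D.∘ η α B) D.∘ F₁ F f   ≡⟨ D.assoc _ _ _ ⟩
    η β B D.∘ (η α B D.∘ F₁ F f)   ≡⟨ cong (η β B D.∘_) (natural α f) ⟩
    η β B D.∘ (F₁ G f D.∘ η α A)   ≡⟨ D.assoc _ _ _ ⟨
    (η β B D.∘ F₁ G f) D.∘ η α A   ≡⟨ cong (D._∘ η α A) (natural β f) ⟩
    (F₁ H f D.∘ η β A) D.∘ η α A   ≡⟨ D.assoc _ _ _ ⟩
    F₁ H f D.∘ (η β A D.∘ η α A)   ∎
    where open ≡-Reasoning

infixr 9 _◃_ _▹_

_◃_ : {C D E : Category ℓ} {F G : Functor C D} (H : Functor D E) →
      NatTrans F G → NatTrans (H ∘F F) (H ∘F G)
(H ◃ α) .η A = F₁ H (η α A)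
_◃_ {F = F} {G} H α .natural f =
  trans (sym (F-∘ H (η α _) (F₁ F f)))
        (trans (cong (F₁ H) (natural α f)) (F-∘ H (F₁ G f) (η α _)))

_▹_ : {B C D : Category ℓ} {F G : Functor C D} →
      NatTrans F G → (K : Functor B C) → NatTrans (F ∘F K) (G ∘F K)
(α ▹ K) .η A       = η α (F₀ K A)
(α ▹ K) .natural f = natural α (F₁ K f)

------------------------------------------------------------------------
-- Finite limits of categories

module _ {A B C : Category ℓ} (F : Functor A C) (G : Functor B C) where
  private
    module A = Category A
    module B = Category B

  record PullbackObj : Set (lsuc ℓ) where
    constructor pbObj
    field
      fst   : Obj A
      snd   : Obj B
      agree : F₀ F fst ≡ F₀ G snd

  open PullbackObj

  record PullbackHom (x y : PullbackObj) : Set ℓ where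
    constructor pbHom
    field
      fst₁   : A.Hom (fst x) (fst y)
      snd₁   : B.Hom (snd x) (snd y)
      agree₁ : C [ F₁ F fst₁ ≋ F₁ G snd₁ ]

  open PullbackHom

  pullbackHom-≡ : ∀ {x y} {f g : PullbackHom x y} →
                  fst₁ f ≡ fst₁ g → snd₁ f ≡ snd₁ g → f ≡ g
  pullbackHom-≡ {f = pbHom a b p} {pbHom .a .b q} refl refl =
    cong (pbHom a b) (≋-irrelevant p q)

  Pullback : Category ℓ
  Pullback = record
    { Obj = PullbackObj
    ; Hom = PullbackHom
    ; id  = λ {x} → pbHom A.id B.id
        (≋-trans (≋-reflexive (F-id F)) (≋-trans (≋-id (agree x)) (≋-reflexive (sym (F-id G)))))
    ; _∘_ = λ g f → pbHom (fst₁ g A.∘ fst₁ f) (snd₁ g B.∘ snd₁ f)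
        (≋-trans (≋-reflexive (F-∘ F (fst₁ g) (fst₁ f)))
                 (≋-trans (≋-∘ (agree₁ g) (agree₁ f))
                          (≋-reflexive (sym (F-∘ G (snd₁ g) (snd₁ f))))))
    ; identityˡ = λ f → pullbackHom-≡ (A.identityˡ _) (B.identityˡ _)
    ; identityʳ = λ f → pullbackHom-≡ (A.identityʳ _) (B.identityʳ _)
    ; assoc     = λ h g f → pullbackHom-≡ (A.assoc _ _ _) (B.assoc _ _ _)
    }

  π₁ : Functor Pullback A
  π₁ .F₀      = fst
  π₁ .F₁      = fst₁
  π₁ .F-id    = refl
  π₁ .F-∘ _ _ = refl

  π₂ : Functor Pullback B
  π₂ .F₀      = snd
  π₂ .F₁      = snd₁
  π₂ .F-id    = refl
  π₂ .F-∘ _ _ = refl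

  pullbackCone : {X : Category ℓ} (H : Functor X A) (K : Functor X B) →
                 F ∘F H ≐ G ∘F K → Functor X Pullback
  pullbackCone H K eq .F₀ x =
    pbObj (F₀ H x) (F₀ K x) (≐-obj {F = F ∘F H} {G ∘F K} eq x)
  pullbackCone H K eq .F₁ f    = pbHom (F₁ H f) (F₁ K f) (eq f)
  pullbackCone H K eq .F-id    = pullbackHom-≡ (F-id H) (F-id K)
  pullbackCone H K eq .F-∘ g f = pullbackHom-≡ (F-∘ H g f) (F-∘ K g f)

module _ {A C : Category ℓ} (F G : Functor A C) where
  private module A = Category A

  record EqualizerObj : Set (lsuc ℓ) where
    constructor eqObj
    field
      obj   : Obj A
      agree : F₀ F obj ≡ F₀ G obj

  open EqualizerObj

  record EqualizerHom (x y : EqualizerObj) : Set ℓ where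
    constructor eqHom
    field
      hom    : A.Hom (obj x) (obj y)
      agree₁ : C [ F₁ F hom ≋ F₁ G hom ]

  open EqualizerHom

  equalizerHom-≡ : ∀ {x y} {f g : EqualizerHom x y} → hom f ≡ hom g → f ≡ g
  equalizerHom-≡ {f = eqHom a p} {eqHom .a q} refl = cong (eqHom a) (≋-irrelevant p q)

  Equalizer : Category ℓ
  Equalizer = record
    { Obj = EqualizerObj
    ; Hom = EqualizerHom
    ; id  = λ {x} → eqHom A.id
        (≋-trans (≋-reflexive (F-id F)) (≋-trans (≋-id (agree x)) (≋-reflexive (sym (F-id G)))))
    ; _∘_ = λ g f → eqHom (hom g A.∘ hom f)
        (≋-trans (≋-reflexive (F-∘ F (hom g) (hom f)))
                 (≋-trans (≋-∘ (agree₁ g) (agree₁ f))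
                          (≋-reflexive (sym (F-∘ G (hom g) (hom f))))))
    ; identityˡ = λ f → equalizerHom-≡ (A.identityˡ _)
    ; identityʳ = λ f → equalizerHom-≡ (A.identityʳ _)
    ; assoc     = λ h g f → equalizerHom-≡ (A.assoc _ _ _)
    }

  ι : Functor Equalizer A
  ι .F₀      = obj
  ι .F₁      = hom
  ι .F-id    = refl
  ι .F-∘ _ _ = refl

  equalizerCone : {X : Category ℓ} (H : Functor X A) → F ∘F H ≐ G ∘F H → Functor X Equalizer
  equalizerCone H eq .F₀ x    = eqObj (F₀ H x) (≐-obj {F = F ∘F H} {G ∘F H} eq x)
  equalizerCone H eq .F₁ f    = eqHom (F₁ H f) (eq f)
  equalizerCone H eq .F-id    = equalizerHom-≡ (F-id H)
  equalizerCone H eq .F-∘ g f = equalizerHom-≡ (F-∘ H g f)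

module _ (X : Category ℓ) where
  private module X = Category X

  Power : ℕ → Category ℓ
  Power zero = record
    { Obj = ⊤
    ; Hom = λ _ _ → ⊤
    ; identityˡ = λ _ → refl
    ; identityʳ = λ _ → refl
    ; assoc     = λ _ _ _ → refl
    }
  Power (suc n) = record
    { Obj = Obj X × Xⁿ.Obj
    ; Hom = λ { (a , as) (b , bs) → X.Hom a b × Xⁿ.Hom as bs }
    ; id  = X.id , Xⁿ.id
    ; _∘_ = λ { (g , gs) (f , fs) → g X.∘ f , gs Xⁿ.∘ fs }
    ; identityˡ = λ { (f , fs) → cong₂ _,_ (X.identityˡ f) (Xⁿ.identityˡ fs) }
    ; identityʳ = λ { (f , fs) → cong₂ _,_ (X.identityʳ f) (Xⁿ.identityʳ fs) }
    ; assoc     = λ { (h , hs) (g , gs) (f , fs) →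
                      cong₂ _,_ (X.assoc h g f) (Xⁿ.assoc hs gs fs) }
    }
    where module Xⁿ = Category (Power n)

  proj : ∀ {n} → Fin n → Functor (Power n) X
  proj {suc n} zero .F₀ (a , _)            = a
  proj {suc n} zero .F₁ (f , _)            = f
  proj {suc n} zero .F-id                  = refl
  proj {suc n} zero .F-∘ _ _               = refl
  proj {suc n} (suc i) .F₀ (_ , as)        = F₀ (proj i) as
  proj {suc n} (suc i) .F₁ (_ , fs)        = F₁ (proj i) fs
  proj {suc n} (suc i) .F-id               = F-id (proj i)
  proj {suc n} (suc i) .F-∘ (_ , gs) (_ , fs) = F-∘ (proj i) gs fs

  powerCone : ∀ {n} {A : Category ℓ} → (Fin n → Functor A X) → Functor A (Power n)
  powerCone {zero} H .F₀ _       = tt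
  powerCone {zero} H .F₁ _       = tt
  powerCone {zero} H .F-id       = refl
  powerCone {zero} H .F-∘ _ _    = refl
  powerCone {suc n} H .F₀ a      = F₀ (H zero) a , F₀ (powerCone (H ∘′ suc)) a
  powerCone {suc n} H .F₁ f      = F₁ (H zero) f , F₁ (powerCone (H ∘′ suc)) f
  powerCone {suc n} H .F-id      = cong₂ _,_ (F-id (H zero)) (F-id (powerCone (H ∘′ suc)))
  powerCone {suc n} H .F-∘ g f   = cong₂ _,_ (F-∘ (H zero) g f) (F-∘ (powerCone (H ∘′ suc)) g f)

module _ (X : Category ℓ) where
  private module X = Category X

  record ArrowObj : Set (lsuc ℓ) where
    constructor arrow
    field
      {source} {target} : Obj X
      arr               : X.Hom source target

  open ArrowObj

  record Square (f g : ArrowObj) : Set ℓ where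
    constructor square
    field
      top      : X.Hom (source f) (source g)
      bottom   : X.Hom (target f) (target g)
      commutes : bottom X.∘ arr f ≡ arr g X.∘ top

  open Square

  square-≡ : ∀ {f g} {s t : Square f g} → top s ≡ top t → bottom s ≡ bottom t → s ≡ t
  square-≡ {s = square a b p} {square .a .b q} refl refl = cong (square a b) (uip p q)

  Arrow : Category ℓ
  Arrow = record
    { Obj = ArrowObj
    ; Hom = Square
    ; id  = square X.id X.id (trans (X.identityˡ _) (sym (X.identityʳ _)))
    ; _∘_ = λ {f} {g} {h} t s → square (top t X.∘ top s) (bottom t X.∘ bottom s) (begin
        (bottom t X.∘ bottom s) X.∘ arr f  ≡⟨ X.assoc _ _ _ ⟩
        bottom t X.∘ (bottom s X.∘ arr f)  ≡⟨ cong (bottom t X.∘_) (commutes s) ⟩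
        bottom t X.∘ (arr g X.∘ top s)     ≡⟨ X.assoc _ _ _ ⟨
        (bottom t X.∘ arr g) X.∘ top s     ≡⟨ cong (X._∘ top s) (commutes t) ⟩
        (arr h X.∘ top t) X.∘ top s        ≡⟨ X.assoc _ _ _ ⟩
        arr h X.∘ (top t X.∘ top s)        ∎)
    ; identityˡ = λ s → square-≡ (X.identityˡ _) (X.identityˡ _)
    ; identityʳ = λ s → square-≡ (X.identityʳ _) (X.identityʳ _)
    ; assoc     = λ u t s → square-≡ (X.assoc _ _ _) (X.assoc _ _ _)
    }
    where open ≡-Reasoning

  dom : Functor Arrow X
  dom .F₀      = source
  dom .F₁      = top
  dom .F-id    = refl
  dom .F-∘ _ _ = refl

  cod : Functor Arrow X
  cod .F₀      = target
  cod .F₁      = bottom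
  cod .F-id    = refl
  cod .F-∘ _ _ = refl

  tautological : NatTrans dom cod
  tautological .η         = arr
  tautological .natural s = sym (commutes s)

  arrowCone : {A : Category ℓ} {F G : Functor A X} → NatTrans F G → Functor A Arrow
  arrowCone α .F₀ a = arrow (η α a)
  arrowCone {F = F} {G} α .F₁ f = square (F₁ F f) (F₁ G f) (sym (natural α f))
  arrowCone {F = F} {G} α .F-id = square-≡ (F-id F) (F-id G)
  arrowCone {F = F} {G} α .F-∘ g f = square-≡ (F-∘ F g f) (F-∘ G g f)

arrow-≡ : {X : Category ℓ} → let open Category X in
          ∀ {A B A′ B′} {f : Hom A B} {g : Hom A′ B′} →
          X [ f ≋ g ] → arrow {X = X} f ≡ arrow g
arrow-≡ refl = refl

------------------------------------------------------------------------
-- Fibrations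

module _ {E B : Category ℓ} (h : Functor E B) where
  private
    module E = Category E
    module B = Category B

  Cartesian : ∀ {A A′} → E.Hom A A′ → Set (lsuc ℓ)
  Cartesian {A} {A′} f =
    ∀ {D} (g : E.Hom D A′) (w : B.Hom (F₀ h D) (F₀ h A)) → F₁ h f B.∘ w ≡ F₁ h g →
    ∃! _≡_ λ (k : E.Hom D A) → F₁ h k ≡ w × f E.∘ k ≡ g

  Opcartesian : ∀ {A A′} → E.Hom A A′ → Set (lsuc ℓ)
  Opcartesian {A} {A′} f =
    ∀ {D} (g : E.Hom A D) (w : B.Hom (F₀ h A′) (F₀ h D)) → w B.∘ F₁ h f ≡ F₁ h g →
    ∃! _≡_ λ (k : E.Hom A′ D) → F₁ h k ≡ w × k E.∘ f ≡ g

  record CartesianLift {x : Obj B} (A : Obj E) (u : B.Hom x (F₀ h A)) : Set (lsuc ℓ) where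
    field
      {obj}     : Obj E
      lift      : E.Hom obj A
      over      : B [ F₁ h lift ≋ u ]
      cartesian : Cartesian lift

  record OpcartesianLift {x : Obj B} (A : Obj E) (u : B.Hom (F₀ h A) x) : Set (lsuc ℓ) where
    field
      {obj}       : Obj E
      lift        : E.Hom A obj
      over        : B [ F₁ h lift ≋ u ]
      opcartesian : Opcartesian lift

  Fibration : Set (lsuc ℓ)
  Fibration = ∀ {x} A (u : B.Hom x (F₀ h A)) → CartesianLift A u

  Opfibration : Set (lsuc ℓ)
  Opfibration = ∀ {x} A (u : B.Hom (F₀ h A) x) → OpcartesianLift A u

  Vertical : ∀ {A A′} → Obj B → E.Hom A A′ → Set ℓ
  Vertical x f = B [ F₁ h f ≋ B.id {x} ]

  record FiberObj (x : Obj B) : Set (lsuc ℓ) where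
    constructor fiberObj
    field
      obj  : Obj E
      over : F₀ h obj ≡ x

  record FiberHom {x : Obj B} (A A′ : FiberObj x) : Set ℓ where
    constructor fiberHom
    field
      hom      : E.Hom (FiberObj.obj A) (FiberObj.obj A′)
      vertical : Vertical x hom

  open FiberHom

  fiberHom-≡ : ∀ {x} {A A′ : FiberObj x} {f g : FiberHom A A′} → hom f ≡ hom g → f ≡ g
  fiberHom-≡ {f = fiberHom a p} {fiberHom .a q} refl = cong (fiberHom a) (≋-irrelevant p q)

  Fiber : Obj B → Category ℓ
  Fiber x = record
    { Obj = FiberObj x
    ; Hom = FiberHom
    ; id  = λ {A} → fiberHom E.id (≋-trans (≋-reflexive (F-id h)) (≋-id (FiberObj.over A)))
    ; _∘_ = λ g f → fiberHom (hom g E.∘ hom f)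
        (≋-trans (≋-reflexive (F-∘ h (hom g) (hom f)))
                 (≋-trans (≋-∘ (vertical g) (vertical f)) (≋-reflexive (B.identityˡ B.id))))
    ; identityˡ = λ f → fiberHom-≡ (E.identityˡ _)
    ; identityʳ = λ f → fiberHom-≡ (E.identityʳ _)
    ; assoc     = λ _ _ _ → fiberHom-≡ (E.assoc _ _ _)
    }

PreservesCartesian : {E E′ B : Category ℓ} (h : Functor E B) (h′ : Functor E′ B) →
                     Functor E E′ → Set (lsuc ℓ)
PreservesCartesian {E = E} h h′ Λ =
  ∀ {A A′} (f : Hom A A′) → Cartesian h f → Cartesian h′ (F₁ Λ f)
  where open Category E

------------------------------------------------------------------------
-- Universal properties inside a category

module _ (C : Category ℓ) where
  open Category C hiding (Obj)

  IsTerminal : Obj C → Set (lsuc ℓ)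
  IsTerminal T = ∀ A → Σ (Hom A T) λ f → ∀ g → f ≡ g

  IsInitial : Obj C → Set (lsuc ℓ)
  IsInitial I = ∀ A → Σ (Hom I A) λ f → ∀ g → f ≡ g

  record IsProduct (A B P : Obj C) : Set (lsuc ℓ) where
    field
      fst       : Hom P A
      snd       : Hom P B
      universal : ∀ {D} (f : Hom D A) (g : Hom D B) →
                  ∃! _≡_ λ (k : Hom D P) → fst ∘ k ≡ f × snd ∘ k ≡ g

    ⟨_,_⟩ : ∀ {D} → Hom D A → Hom D B → Hom D P
    ⟨ f , g ⟩ = proj₁ (universal f g)

  record IsExponential (A B E : Obj C) : Set (lsuc ℓ) where
    field
      {E×A}     : Obj C
      product   : IsProduct E A E×A
      eval      : Hom E×A B
      universal : ∀ {D D×A} (q : IsProduct D A D×A) (f : Hom D×A B) →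
                  ∃! _≡_ λ (k : Hom D E) →
                    eval ∘ IsProduct.⟨_,_⟩ product (k ∘ IsProduct.fst q) (IsProduct.snd q) ≡ f

------------------------------------------------------------------------
-- Judgemental theories

RuleSet : (ℓ : Level) → Set (lsuc (lsuc (lsuc ℓ)))
RuleSet ℓ = {A B : Category ℓ} → Functor A B → Set (lsuc (lsuc ℓ))

PolicySet : (ℓ : Level) → Set (lsuc (lsuc (lsuc ℓ)))
PolicySet ℓ = {A B : Category ℓ} {F G : Functor A B} → NatTrans F G → Set (lsuc (lsuc ℓ))

-- L is (F , H) ↦ (Λ F , H[Λ♯_F]) and σ consists of the lifts H[Λ♯_F] → H, for
-- some choice of these lifts; the action of L on morphisms is then forced by
-- naturality of σ and cartesianness.

record SharpLifting {F G H X : Category ℓ}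
  (Λ : Functor F G) (r : Functor F X) (r′ : Functor G X) (Λ♯ : NatTrans (r′ ∘F Λ) r)
  (h : Functor H X) (L : Functor (Pullback r h) (Pullback r′ h))
  (σ : NatTrans (π₂ r′ h ∘F L) (π₂ r h)) : Set (lsuc ℓ) where
  field
    over-Λ    : π₁ r′ h ∘F L ≐ Λ ∘F π₁ r h
    over-Λ♯   : ∀ z → X [ F₁ h (η σ z) ≋ η Λ♯ (F₀ (π₁ r h) z) ]
    cartesian : ∀ z → Cartesian h (η σ z)

record FlatLifting {F G H X : Category ℓ}
  (Λ : Functor F G) (r : Functor F X) (r′ : Functor G X) (Λ♭ : NatTrans r (r′ ∘F Λ))
  (h : Functor H X) (L : Functor (Pullback r h) (Pullback r′ h))
  (σ : NatTrans (π₂ r h) (π₂ r′ h ∘F L)) : Set (lsuc ℓ) where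
  field
    over-Λ      : π₁ r′ h ∘F L ≐ Λ ∘F π₁ r h
    over-Λ♭     : ∀ z → X [ F₁ h (η σ z) ≋ η Λ♭ (F₀ (π₁ r h) z) ]
    opcartesian : ∀ z → Opcartesian h (η σ z)

-- RuleStep R P and PolicyStep R P are the rules and policies obtained from R
-- and P by one application of a closure condition.  A category X belongs to
-- the theory when its identity functor is a rule.  The *-resp conditions only
-- say that R and P do not distinguish extensionally equal functors and
-- transformations.

data RuleStep (R : RuleSet ℓ) (P : PolicySet ℓ) : RuleSet ℓ where

  id-source : ∀ {A B} {F : Functor A B} → R F → RuleStep R P (idF {C = A})
  id-target : ∀ {A B} {F : Functor A B} → R F → RuleStep R P (idF {C = B})
  compose   : ∀ {A B C} {G : Functor B C} {F : Functor A B} →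
              R G → R F → RuleStep R P (G ∘F F)
  rule-resp : ∀ {A B} {F G : Functor A B} → F ≐ G → R F → RuleStep R P G

  policy-source : ∀ {A B} {F G : Functor A B} {α : NatTrans F G} → P α → RuleStep R P F
  policy-target : ∀ {A B} {F G : Functor A B} {α : NatTrans F G} → P α → RuleStep R P G

  pullback-π₁   : ∀ {A B C} {F : Functor A C} {G : Functor B C} →
                  R F → R G → RuleStep R P (π₁ F G)
  pullback-π₂   : ∀ {A B C} {F : Functor A C} {G : Functor B C} →
                  R F → R G → RuleStep R P (π₂ F G)
  pullback-cone : ∀ {X A B C} {F : Functor A C} {G : Functor B C}
                  {H : Functor X A} {K : Functor X B} (eq : F ∘F H ≐ G ∘F K) →
                  R F → R G → R H → R K → RuleStep R P (pullbackCone F G H K eq)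

  equalizer-ι    : ∀ {A C} {F G : Functor A C} → R F → R G → RuleStep R P (ι F G)
  equalizer-cone : ∀ {X A C} {F G : Functor A C} {H : Functor X A} (eq : F ∘F H ≐ G ∘F H) →
                   R F → R G → R H → RuleStep R P (equalizerCone F G H eq)

  power-proj : ∀ {X n} (i : Fin n) → R (idF {C = X}) → RuleStep R P (proj X i)
  power-cone : ∀ {A X n} {H : Fin n → Functor A X} →
               R (idF {C = A}) → R (idF {C = X}) → (∀ i → R (H i)) →
               RuleStep R P (powerCone X H)

  arrow-dom  : ∀ {X} → R (idF {C = X}) → RuleStep R P (dom X)
  arrow-cod  : ∀ {X} → R (idF {C = X}) → RuleStep R P (cod X)
  arrow-cone : ∀ {A X} {F G : Functor A X} {α : NatTrans F G} →
               P α → RuleStep R P (arrowCone X α)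

  sharp : ∀ {F G H X} {Λ : Functor F G} {r : Functor F X} {r′ : Functor G X}
          {Λ♯ : NatTrans (r′ ∘F Λ) r} {h : Functor H X}
          {L : Functor (Pullback r h) (Pullback r′ h)}
          {σ : NatTrans (π₂ r′ h ∘F L) (π₂ r h)} →
          R Λ → R r → R r′ → P Λ♯ → R h → Fibration h →
          SharpLifting Λ r r′ Λ♯ h L σ → RuleStep R P L
  flat  : ∀ {F G H X} {Λ : Functor F G} {r : Functor F X} {r′ : Functor G X}
          {Λ♭ : NatTrans r (r′ ∘F Λ)} {h : Functor H X}
          {L : Functor (Pullback r h) (Pullback r′ h)}
          {σ : NatTrans (π₂ r h) (π₂ r′ h ∘F L)} →
          R Λ → R r → R r′ → P Λ♭ → R h → Opfibration h →
          FlatLifting Λ r r′ Λ♭ h L σ → RuleStep R P L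

-- The *-joint conditions are the two-dimensional part of the universal
-- properties of the limits.

data PolicyStep (R : RuleSet ℓ) (P : PolicySet ℓ) : PolicySet ℓ where

  identity    : ∀ {A B} {F : Functor A B} → R F → PolicyStep R P (idN {F = F})
  compose     : ∀ {A B} {F G H : Functor A B} {β : NatTrans G H} {α : NatTrans F G} →
                P β → P α → PolicyStep R P (β ∘N α)
  policy-resp : ∀ {A B} {F G F′ G′ : Functor A B} {α : NatTrans F G} {β : NatTrans F′ G′} →
                F ≐ F′ → G ≐ G′ → α ≐ⁿ β → P α → PolicyStep R P β
  whisker-◃   : ∀ {A B C} {F G : Functor A B} {α : NatTrans F G} {H : Functor B C} →
                R H → P α → PolicyStep R P (H ◃ α)
  whisker-▹   : ∀ {A B C} {F G : Functor B C} {α : NatTrans F G} {K : Functor A B} →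
                P α → R K → PolicyStep R P (α ▹ K)

  arrow-tautological : ∀ {X} → R (idF {C = X}) → PolicyStep R P (tautological X)

  pullback-joint  : ∀ {X A B C} {F : Functor A C} {G : Functor B C}
                    {H K : Functor X (Pullback F G)} {α : NatTrans H K} →
                    R F → R G → R H → R K →
                    P (π₁ F G ◃ α) → P (π₂ F G ◃ α) → PolicyStep R P α
  equalizer-joint : ∀ {X A C} {F G : Functor A C}
                    {H K : Functor X (Equalizer F G)} {α : NatTrans H K} →
                    R F → R G → R H → R K → P (ι F G ◃ α) → PolicyStep R P α
  power-joint     : ∀ {A X n} {H K : Functor A (Power X n)} {α : NatTrans H K} →
                    R H → R K → (∀ i → P (proj X {n} i ◃ α)) → PolicyStep R P α
  arrow-joint     : ∀ {A X} {H K : Functor A (Arrow X)} {α : NatTrans H K} →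
                    R H → R K → P (dom X ◃ α) → P (cod X ◃ α) → PolicyStep R P α

  sharp : ∀ {F G H X} {Λ : Functor F G} {r : Functor F X} {r′ : Functor G X}
          {Λ♯ : NatTrans (r′ ∘F Λ) r} {h : Functor H X}
          {L : Functor (Pullback r h) (Pullback r′ h)}
          {σ : NatTrans (π₂ r′ h ∘F L) (π₂ r h)} →
          R Λ → R r → R r′ → P Λ♯ → R h → Fibration h →
          SharpLifting Λ r r′ Λ♯ h L σ → PolicyStep R P σ
  flat  : ∀ {F G H X} {Λ : Functor F G} {r : Functor F X} {r′ : Functor G X}
          {Λ♭ : NatTrans r (r′ ∘F Λ)} {h : Functor H X}
          {L : Functor (Pullback r h) (Pullback r′ h)}
          {σ : NatTrans (π₂ r h) (π₂ r′ h ∘F L)} →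
          R Λ → R r → R r′ → P Λ♭ → R h → Opfibration h →
          FlatLifting Λ r r′ Λ♭ h L σ → PolicyStep R P σ

record JudgementalTheory (ℓ : Level) : Set (lsuc (lsuc (lsuc ℓ))) where
  field
    ctx           : Category ℓ
    ◇             : Obj ctx
    ◇-terminal    : IsTerminal ctx ◇
    Rule          : RuleSet ℓ
    Policy        : PolicySet ℓ
    rule-closed   : ∀ {A B} {F : Functor A B} → RuleStep Rule Policy F → Rule F
    policy-closed : ∀ {A B} {F G : Functor A B} {α : NatTrans F G} →
                    PolicyStep Rule Policy α → Policy α

  Judgement : {A : Category ℓ} → Functor A ctx → Set (lsuc (lsuc ℓ))
  Judgement F = Rule F

module _ (Gen : RuleSet ℓ) where

  data GeneratedRule : RuleSet ℓ
  data GeneratedPolicy : PolicySet ℓ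

  data GeneratedRule where
    generator : ∀ {A B} {F : Functor A B} → Gen F → GeneratedRule F
    step      : ∀ {A B} {F : Functor A B} →
                RuleStep GeneratedRule GeneratedPolicy F → GeneratedRule F

  data GeneratedPolicy where
    step : ∀ {A B} {F G : Functor A B} {α : NatTrans F G} →
           PolicyStep GeneratedRule GeneratedPolicy α → GeneratedPolicy α

generatedBy : (ctx : Category ℓ) (◇ : Obj ctx) → IsTerminal ctx ◇ → RuleSet ℓ →
              JudgementalTheory ℓ
generatedBy ctx ◇ ◇-terminal Gen = record
  { ctx           = ctx
  ; ◇             = ◇
  ; ◇-terminal    = ◇-terminal
  ; Rule          = GeneratedRule Gen
  ; Policy        = GeneratedPolicy Gen
  ; rule-closed   = step
  ; policy-closed = step
  }

------------------------------------------------------------------------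
-- Finite sets

record FiniteSet (ℓ : Level) : Set (lsuc ℓ) where
  field
    Carrier     : Set ℓ
    size        : ℕ
    enumeration : Carrier ↔ Fin size

  open Inverse enumeration public using (to; from; strictlyInverseˡ; strictlyInverseʳ)

open FiniteSet

-- A map between finite sets is given by its table of values, so that
-- extensionally equal maps are equal.

Map : FiniteSet ℓ → FiniteSet ℓ → Set ℓ
Map A B = Vec (Carrier B) (size A)

module _ (A B : FiniteSet ℓ) where

  apply : Map A B → Carrier A → Carrier B
  apply f a = lookup f (to A a)

  table : (Carrier A → Carrier B) → Map A B
  table f = tabulate (f ∘′ from A)

  apply-table : ∀ f a → apply (table f) a ≡ f a
  apply-table f a = trans (lookup∘tabulate _ (to A a)) (cong f (strictlyInverseʳ A a))

  table-apply : ∀ f → table (apply f) ≡ f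
  table-apply f = trans (tabulate-cong λ i → cong (lookup f) (strictlyInverseˡ A i))
                        (tabulate∘lookup f)

  table-cong : ∀ {f g} → (∀ a → f a ≡ g a) → table f ≡ table g
  table-cong f≗g = tabulate-cong λ i → f≗g (from A i)

FinSet : (ℓ : Level) → Category ℓ
FinSet ℓ = record
  { Obj = FiniteSet ℓ
  ; Hom = Map
  ; id  = λ {A} → table A A λ a → a
  ; _∘_ = λ {A} {B} {C} g f → table A C λ a → apply B C g (apply A B f a)
  ; identityˡ = λ {A} {B} f →
      trans (table-cong A B λ a → apply-table B B (λ b → b) (apply A B f a)) (table-apply A B f)
  ; identityʳ = λ {A} {B} f →
      trans (table-cong A B λ a → cong (apply A B f) (apply-table A A (λ a′ → a′) a))
            (table-apply A B f)
  ; assoc     = λ {A} {B} {C} {D} h g f → table-cong A D λ a →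
      trans (apply-table B D (λ b → apply C D h (apply B C g b)) (apply A B f a))
            (sym (cong (apply C D h) (apply-table A C (λ a′ → apply B C g (apply A B f a′)) a)))
  }

singleton : FiniteSet ℓ
singleton = record
  { Carrier     = ⊤
  ; size        = 1
  ; enumeration = mk↔ₛ′ (λ _ → zero) (λ _ → tt) (λ { zero → refl }) (λ _ → refl)
  }

singleton-terminal : IsTerminal (FinSet ℓ) singleton
singleton-terminal A = table A singleton (λ _ → tt) , λ g → table-apply A singleton g

------------------------------------------------------------------------
-- The fibrewise dual of a faithful fibration

-- A morphism A → A′ over u is a vertical arrow u*A′ → A.

module _ {E B : Category ℓ} (p : Functor E B) (cleavage : Fibration p) (faithful : Faithful p) where
  private
    module E = Category E
    module B = Category B

    module Lift {x} {A} (u : B.Hom x (F₀ p A)) = CartesianLift (cleavage A u)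

    factor : ∀ {A A′ D} {x y z} {f : E.Hom A A′} {g : E.Hom D A′} {u : B.Hom y z} {w : B.Hom x y} →
             Cartesian p f → B [ F₁ p f ≋ u ] → B [ F₁ p g ≋ u B.∘ w ] →
             Σ (E.Hom D A) λ k → B [ F₁ p k ≋ w ]
    factor {g = g} {w = w} f-cart refl pg≋ with refl ← ≋-dom pg≋ =
      let k , (pk≡w , _) , _ = f-cart g w (sym (≋⇒≡ pg≋)) in k , ≋-reflexive pk≡w

  record DualHom (A A′ : Obj E) : Set ℓ where
    constructor dualHom
    field
      base     : B.Hom (F₀ p A) (F₀ p A′)
      fibre    : E.Hom (CartesianLift.obj (cleavage A′ base)) A
      vertical : Vertical p (F₀ p A) fibre

  open DualHom

  dualHom-≡ : ∀ {A A′} {f g : DualHom A A′} → base f ≡ base g → f ≡ g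
  dualHom-≡ {f = dualHom u a a-vert} {dualHom .u b b-vert} refl
    with refl ← faithful {f = a} {b} (≋⇒≡ (≋-trans a-vert (≋-sym b-vert))) =
    cong (dualHom u a) (≋-irrelevant a-vert b-vert)

  dualCompose : ∀ {A A′ A″} → DualHom A′ A″ → DualHom A A′ → DualHom A A″
  dualCompose (dualHom v b b-vert) (dualHom u a a-vert) =
    let k , pk = factor (Lift.cartesian v) (Lift.over v) (Lift.over (v B.∘ u))
        m , pm = factor (Lift.cartesian u) (Lift.over u)
                   (≋-trans (≋-reflexive (F-∘ p b k))
                   (≋-trans (≋-∘ b-vert pk)
                            (≋-reflexive (trans (B.identityˡ u) (sym (B.identityʳ u))))))
    in dualHom (v B.∘ u) (a E.∘ m)
         (≋-trans (≋-reflexive (F-∘ p a m))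
         (≋-trans (≋-∘ a-vert pm) (≋-reflexive (B.identityˡ B.id))))

  Dual : Category ℓ
  Dual = record
    { Obj = Obj E
    ; Hom = DualHom
    ; id  = dualHom B.id (Lift.lift B.id) (Lift.over B.id)
    ; _∘_ = dualCompose
    ; identityˡ = λ f → dualHom-≡ (B.identityˡ _)
    ; identityʳ = λ f → dualHom-≡ (B.identityʳ _)
    ; assoc     = λ _ _ _ → dualHom-≡ (B.assoc _ _ _)
    }

  dual : Functor Dual B
  dual .F₀ A    = F₀ p A
  dual .F₁      = base
  dual .F-id    = refl
  dual .F-∘ _ _ = refl

------------------------------------------------------------------------
-- Natural deduction theories

-- Substitutionality is a condition on the generating data: p is a fibration
-- and the operators preserve cartesian arrows (there are no generating
-- policies).  It cannot be asked of the whole generated theory: the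
-- equalizer of dom , cod : ctx² → ctx is the category of endomaps, whose
-- projection to ctx is a judgement but not a fibration.
--
-- As p is faithful, the action of an operator on morphisms is forced by its
-- action on objects.

record NaturalDeductionTheory (ℓ : Level) : Set (lsuc (lsuc ℓ)) where
  field
    ℙ        : Category ℓ
    p        : Functor ℙ (FinSet ℓ)
    cleavage : Fibration p
    faithful : Faithful p

  ℙᵒ : Category ℓ
  ℙᵒ = Dual p cleavage faithful

  pᵒ : Functor ℙᵒ (FinSet ℓ)
  pᵒ = dual p cleavage faithful

  field
    truth            : Functor (FinSet ℓ) ℙ
    truth-over       : p ∘F truth ≐ idF
    truth-terminal   : ∀ x → IsTerminal (Fiber p x)
                         (fiberObj (F₀ truth x) (≐-obj {F = p ∘F truth} {idF} truth-over x))
    truth-cartesian  : PreservesCartesian idF p truth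

    conj             : Functor (Pullback p p) ℙ
    conj-over        : p ∘F conj ≐ p ∘F π₁ p p
    conj-product     : ∀ (z : Obj (Pullback p p)) → let pbObj φ ψ φ~ψ = z in
                       IsProduct (Fiber p (F₀ p φ)) (fiberObj φ refl) (fiberObj ψ (sym φ~ψ))
                         (fiberObj (F₀ conj z)
                                   (≐-obj {F = p ∘F conj} {p ∘F π₁ p p} conj-over z))
    conj-cartesian   : PreservesCartesian (p ∘F π₁ p p) p conj

    falsum           : Functor (FinSet ℓ) ℙ
    falsum-over      : p ∘F falsum ≐ idF
    falsum-initial   : ∀ x → IsInitial (Fiber p x)
                         (fiberObj (F₀ falsum x) (≐-obj {F = p ∘F falsum} {idF} falsum-over x))
    falsum-cartesian : PreservesCartesian idF p falsum

    -- Implication is contravariant in its first argument.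
    impl             : Functor (Pullback pᵒ p) ℙ
    impl-over        : p ∘F impl ≐ pᵒ ∘F π₁ pᵒ p
    impl-exponential : ∀ (z : Obj (Pullback pᵒ p)) → let pbObj φ ψ φ~ψ = z in
                       IsExponential (Fiber p (F₀ p φ)) (fiberObj φ refl) (fiberObj ψ (sym φ~ψ))
                         (fiberObj (F₀ impl z)
                                   (≐-obj {F = p ∘F impl} {pᵒ ∘F π₁ pᵒ p} impl-over z))
    impl-cartesian   : PreservesCartesian (pᵒ ∘F π₁ pᵒ p) p impl

module _ (N : NaturalDeductionTheory ℓ) where
  open NaturalDeductionTheory N

  data NDGenerator : RuleSet ℓ where
    p-rule      : NDGenerator p
    truth-rule  : NDGenerator truth
    conj-rule   : NDGenerator conj
    falsum-rule : NDGenerator falsum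
    impl-rule   : NDGenerator impl

  theory : JudgementalTheory ℓ
  theory = generatedBy (FinSet ℓ) singleton singleton-terminal NDGenerator

------------------------------------------------------------------------
-- Entailment

module Entailment {ℙ ctx : Category ℓ} (p : Functor ℙ ctx) where
  open Category ℙ hiding (Obj; id)

  I : Functor ctx (Arrow ctx)
  I = arrowCone ctx (idN {F = idF})

  p² : Functor (Arrow ℙ) (Arrow ctx)
  p² = arrowCone ctx (p ◃ tautological ℙ)

  𝔼 : Category ℓ
  𝔼 = Pullback I p²

  e : Functor 𝔼 ctx
  e = π₁ I p²

  d : Functor 𝔼 ℙ
  d = dom ℙ ∘F π₂ I p²

  c : Functor 𝔼 ℙ
  c = cod ℙ ∘F π₂ I p²

  -- Pairs whose first component is the arrow composed first.
  𝔼d∙c𝔼 : Category ℓ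
  𝔼d∙c𝔼 = Pullback c d

  module _ (x : Obj ctx) where

    entails : ∀ {ψ φ} (f : Hom ψ φ) → Vertical p x f → Obj 𝔼
    entails f f-vert = pbObj x (arrow f) (arrow-≡ (≋-sym f-vert))

    composable : ∀ {ψ φ χ} (f : Hom ψ φ) (g : Hom φ χ) → Vertical p x f → Vertical p x g → Obj 𝔼d∙c𝔼
    composable f g f-vert g-vert = pbObj (entails f f-vert) (entails g g-vert) refl

    vertical-∘ : ∀ {ψ φ χ} {f : Hom ψ φ} {g : Hom φ χ} →
                 Vertical p x f → Vertical p x g → Vertical p x (g ∘ f)
    vertical-∘ {f = f} {g} f-vert g-vert =
      ≋-trans (≋-reflexive (F-∘ p g f))
      (≋-trans (≋-∘ g-vert f-vert) (≋-reflexive (Category.identityˡ ctx (Category.id ctx))))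

{-# OPTIONS --safe #-}

-- The tautological transformation dom ⇒ cod, whiskered with the two projections
-- of 𝔼d∙c𝔼 to 𝔼, gives two policies between the source, middle and target
-- functors.  Their composite is again a policy, and the rule t is the functor
-- into the arrow category that this composite induces.

module Submission where

open import Axiom.UniquenessOfIdentityProofs.WithK using (uip)
open import Data.Product using (Σ; _×_; _,_)
open import Level using (Level)
open import Relation.Binary.PropositionalEquality using (_≡_; refl; sym; trans; cong)
open import Defs

private variable
  ℓ : Level

module _ {C : Category ℓ} where
  open Category C hiding (Obj)

  ≋-cod : ∀ {A B A′ B′ : Obj C} {f : Hom A B} {g : Hom A′ B′} → C [ f ≋ g ] → B ≡ B′
  ≋-cod refl = refl

  arrow-injective : {f g : ArrowObj C} → f ≡ g → C [ ArrowObj.arr f ≋ ArrowObj.arr g ]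
  arrow-injective refl = refl

  square-≋ : {f g f′ g′ : ArrowObj C} {s : Square C f g} {t : Square C f′ g′} →
             f ≡ f′ → g ≡ g′ →
             C [ Square.top s ≋ Square.top t ] → C [ Square.bottom s ≋ Square.bottom t ] →
             Arrow C [ s ≋ t ]
  square-≋ refl refl top≋ bottom≋ =
    ≋-reflexive (square-≡ C (≋⇒≡ top≋) (≋⇒≡ bottom≋))

F₁-≋ : {C D : Category ℓ} (F : Functor C D) → let open Category C hiding (Obj) in
       ∀ {A B A′ B′ : Obj C} {f : Hom A B} {g : Hom A′ B′} →
       C [ f ≋ g ] → D [ F₁ F f ≋ F₁ F g ]
F₁-≋ F refl = refl

pbObj-≡ : {A B C : Category ℓ} {F : Functor A C} {G : Functor B C} {x y : PullbackObj F G} →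
          PullbackObj.fst x ≡ PullbackObj.fst y → PullbackObj.snd x ≡ PullbackObj.snd y → x ≡ y
pbObj-≡ {x = pbObj a b p} {pbObj .a .b q} refl refl = cong (pbObj a b) (uip p q)

module _ {C D : Category ℓ} (F G : Functor C D) where
  private
    module D = Category D

    -- The end points are variables here rather than values of `F` and `G`, so that matching the
    -- equality with `refl` is possible in this definition and in the two lemmas after it.
    coerce : ∀ {A B} → A ≡ B → D.Hom A B
    coerce refl = D.id

    id≋coerce : ∀ {A B} (eq : A ≡ B) → D [ D.id {A} ≋ coerce eq ]
    id≋coerce refl = refl

    coerce-natural : ∀ {A A′ B B′} (eq : A ≡ A′) (eq′ : B ≡ B′)
                     {f : D.Hom A B} {g : D.Hom A′ B′} → D [ f ≋ g ] →
                     coerce eq′ D.∘ f ≡ g D.∘ coerce eq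
    coerce-natural refl refl f≋g =
      trans (D.identityˡ _) (trans (≋⇒≡ f≋g) (sym (D.identityʳ _)))

  ≐⇒NatTrans : F ≐ G → NatTrans F G
  ≐⇒NatTrans F≐G .η A = coerce (≐-obj {F = F} {G} F≐G A)
  ≐⇒NatTrans F≐G .natural {A} {B} f =
    coerce-natural (≐-obj {F = F} {G} F≐G A) (≐-obj {F = F} {G} F≐G B) (F≐G f)

  -- The two sides have different target functors, so they are compared componentwise up to `≋`.
  -- This is the form in which `policy-resp` carries an identity policy over to the comparison.
  idN≐≐⇒NatTrans : (F≐G : F ≐ G) → idN {F = F} ≐ⁿ ≐⇒NatTrans F≐G
  idN≐≐⇒NatTrans F≐G A = id≋coerce (≐-obj {F = F} {G} F≐G A)

module Composition {ℙ ctx : Category ℓ} (p : Functor ℙ ctx) where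
  open Entailment p
  private
    module ℙ = Category ℙ

  first second : Functor 𝔼d∙c𝔼 (Arrow ℙ)
  first  = π₂ I p² ∘F π₁ c d
  second = π₂ I p² ∘F π₂ c d

  middle≐ : cod ℙ ∘F first ≐ dom ℙ ∘F second
  middle≐ = PullbackHom.agree₁

  -- The pullback makes the target of the first arrow and the source of the second equal only
  -- propositionally, so `∘N` needs this bridge between them.
  middle : NatTrans (cod ℙ ∘F first) (dom ℙ ∘F second)
  middle = ≐⇒NatTrans (cod ℙ ∘F first) (dom ℙ ∘F second) middle≐

  composite : NatTrans (dom ℙ ∘F first) (cod ℙ ∘F second)
  composite = (tautological ℙ ▹ second) ∘N (middle ∘N (tautological ℙ ▹ first))

  abstract
    composite-vertical : ∀ z → Vertical p (F₀ (e ∘F π₁ c d) z) (η composite z)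
    composite-vertical (pbObj (pbObj x (arrow f) f-agree) (pbObj y (arrow g) g-agree) refl)
      with f-vert ← ≋-sym (arrow-injective f-agree)
         | g-vert ← ≋-sym (arrow-injective g-agree)
      -- The shared middle object lies over `x` as the target of `f` and over `y` as the source of
      -- `g`, so the two bases coincide.
      with refl ← trans (sym (≋-cod f-vert)) (≋-dom g-vert) =
      -- With the agreement matched as `refl`, the component of `middle` reduces to an identity,
      -- which leaves `g ∘ (id ∘ f)`.
      ≋-trans (≋-reflexive (cong (λ k → F₁ p (g ℙ.∘ k)) (ℙ.identityˡ f)))
              (vertical-∘ x f-vert g-vert)

    t-cone : I ∘F (e ∘F π₁ c d) ≐ p² ∘F arrowCone ℙ composite
    t-cone {z} {z′} h =
      let pbHom _ _ first-agree  = PullbackHom.fst₁ h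
          pbHom _ _ second-agree = PullbackHom.snd₁ h
      in square-≋
        (arrow-≡ (≋-sym (composite-vertical z))) (arrow-≡ (≋-sym (composite-vertical z′)))
        (F₁-≋ (dom ctx) first-agree)
        -- The base of the first square is carried to the lower edge of the second: across the first
        -- square, over the shared middle edge, then back to the base of the second square and down
        -- to its lower edge.
        (≋-trans (F₁-≋ (cod ctx) first-agree)
        (≋-trans (F₁-≋ p (middle≐ h))
        (≋-trans (≋-sym (F₁-≋ (dom ctx) second-agree))
                 (F₁-≋ (cod ctx) second-agree))))

  t : Functor 𝔼d∙c𝔼 𝔼
  -- Taking the base from the first arrow makes `t-over` hold by computation.
  t = pullbackCone I p² (e ∘F π₁ c d) (arrowCone ℙ composite) t-cone

  t-over : e ∘F t ≐ e ∘F π₁ c d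
  t-over _ = refl

  -- The agreement in `composable` is `refl`, so `middle` contributes only an identity, removed by
  -- the left unit law. The two proofs of verticality are identified by `uip`, through `pbObj-≡`.
  t-composable :
    ∀ x {ψ φ χ} (f : ℙ.Hom ψ φ) (g : ℙ.Hom φ χ)
    (f-vert : Vertical p x f) (g-vert : Vertical p x g) →
    F₀ t (composable x f g f-vert g-vert) ≡ entails x (g ℙ.∘ f) (vertical-∘ x f-vert g-vert)
  t-composable x f g f-vert g-vert =
    pbObj-≡ refl (cong (λ k → arrow (g ℙ.∘ k)) (ℙ.identityˡ f))

module CompositionRule (T : JudgementalTheory ℓ) {ℙ ctx : Category ℓ} {p : Functor ℙ ctx}
                       (p-rule : JudgementalTheory.Rule T p) where
  open JudgementalTheory T using (Rule; Policy; rule-closed; policy-closed)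
  open Entailment p
  open Composition p

  private
    ℙ-rule : Rule (idF {C = ℙ})
    ℙ-rule = rule-closed (id-source p-rule)

    tautological-policy : Policy (tautological ℙ)
    tautological-policy = policy-closed (arrow-tautological ℙ-rule)

    I-rule : Rule I
    I-rule = rule-closed (arrow-cone (policy-closed (identity (rule-closed (id-target p-rule)))))

    p²-rule : Rule p²
    p²-rule = rule-closed (arrow-cone (policy-closed (whisker-◃ p-rule tautological-policy)))

    π₂-rule : Rule (π₂ I p²)
    π₂-rule = rule-closed (pullback-π₂ I-rule p²-rule)

    c-rule : Rule c
    c-rule = rule-closed (compose (rule-closed (arrow-cod ℙ-rule)) π₂-rule)

    d-rule : Rule d
    d-rule = rule-closed (compose (rule-closed (arrow-dom ℙ-rule)) π₂-rule)

    π₁cd-rule : Rule (π₁ c d)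
    π₁cd-rule = rule-closed (pullback-π₁ c-rule d-rule)

    first-rule : Rule first
    first-rule = rule-closed (compose π₂-rule π₁cd-rule)

    second-rule : Rule second
    second-rule = rule-closed (compose π₂-rule (rule-closed (pullback-π₂ c-rule d-rule)))

    middle-policy : Policy middle
    -- The identity on `cod ℙ ∘F first` is a policy; its source is kept and its target is replaced
    -- along `middle≐`.
    middle-policy = policy-closed (policy-resp (λ _ → refl) middle≐
      (idN≐≐⇒NatTrans (cod ℙ ∘F first) (dom ℙ ∘F second) middle≐)
      (policy-closed (identity (rule-closed
        (compose (rule-closed (arrow-cod ℙ-rule)) first-rule)))))

  composite-policy : Policy composite
  composite-policy = policy-closed (compose
    (policy-closed (whisker-▹ tautological-policy second-rule))
    (policy-closed (compose middle-policy
      (policy-closed (whisker-▹ tautological-policy first-rule)))))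

  t-rule : Rule t
  t-rule = rule-closed t-step
    where
    eπ₁-rule : Rule (e ∘F π₁ c d)
    eπ₁-rule = rule-closed (compose (rule-closed (pullback-π₁ I-rule p²-rule)) π₁cd-rule)

    t-step : RuleStep Rule Policy t
    t-step = pullback-cone {F = I} {G = p²} {H = e ∘F π₁ c d} {K = arrowCone ℙ composite}
      t-cone I-rule p²-rule eπ₁-rule (rule-closed (arrow-cone composite-policy))

lemma4p2p2 : ∀ {ℓ : Level} (N : NaturalDeductionTheory ℓ) →
    let open NaturalDeductionTheory N
        open JudgementalTheory (theory N) using (Rule)
        open Entailment p
        open Category ℙ hiding (Obj)
    in
    Σ (Functor 𝔼d∙c𝔼 𝔼) λ t →
      Rule t ×
      (e ∘F t ≐ e ∘F π₁ c d) ×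
      (∀ x {ψ φ χ} (f : Hom ψ φ) (g : Hom φ χ)
         (f-vert : Vertical p x f) (g-vert : Vertical p x g) →
         F₀ t (composable x f g f-vert g-vert)
           ≡ entails x (g ∘ f) (vertical-∘ x f-vert g-vert))
lemma4p2p2 N = t , t-rule , t-over , t-composable
  where
  open NaturalDeductionTheory N
  open Composition p
  open CompositionRule (theory N) (generator p-rule)
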